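{- Let $n,k,t$ be positive integers with $t$ dividing $2nk$, and suppose that there exists an integer $\mathrm{H}_t(n;k)$. (1) If $t$ divides $nk$, then $nk\equiv 0\pmod 4$ or $nk\equiv -t\equiv \pm1\pmod 4$. (2) If $t=2nk$, then $k$ must be even. (3) If $t\neq 2nk$ and $t$ does not divide $nk$, then $t+2nk\equiv 0\pmod 8$.
   Context: A partially filled (p.f.) $m\times n$ array is an $m\times n$ matrix in which some cells are allowed to be empty. Let $n,k,t$ be positive integers such that $t$ divides $2nk$, let $v=2nk+t$, and let $J$ be the subgroup of $\mathbb{Z}_v$ of order $t$. An $\mathrm{H}_t(n;k)$ (square Heffter array over $\mathbb{Z}_v$ relative to $J$) is an $n\times n$ p.f. array with elements in $\mathbb{Z}_v$ such that: each row and each column contains exactly $k$ filled cells; for every $x\in\mathbb{Z}_v\setminus J$, either $x$ or $-x$ appears in the array; the elements in every row and every column sum to $0$ in $\mathbb{Z}_v$. It is called integer if the elements in every row and every column, viewed as integers in $\pm\{1,\ldots,\lfloor\frac{2nk+t}{2}\rfloor\}$, sum to zero in $\mathbb{Z}$. -}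

module Defs where

open import Data.Bool using (if_then_else_)
open import Data.Fin using (Fin; toℕ)
open import Data.Fin.Subset using (Subset; _∈_; _∉_)
open import Data.Integer as ℤ using (ℤ; +_; 0ℤ; _⊖_)
import Data.Integer.Divisibility.Signed as ℤ
open import Data.List using (List; length; foldr; map; tabulate; catMaybes)
open import Data.Maybe using (Maybe; just)
open import Data.Nat using (ℕ; _+_; _*_; _∸_; _≤ᵇ_; ⌊_/2⌋; NonZero; >-nonZero; >-nonZero⁻¹)
open import Data.Nat.DivMod using (_mod_)
open import Data.Nat.Properties using (≤-trans; m≤n+m)
open import Data.Product using (∃₂)
open import Data.Sum using (_⊎_)
open import Relation.Binary.PropositionalEquality using (_≡_)

infix 4 _≡_[mod_]

_≡_[mod_] : ℤ → ℤ → ℕ → Set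
a ≡ b [mod m ] = (+ m) ℤ.∣ (a ℤ.- b)

-- The cyclic group ℤ_v, carried by Fin v.
module _ {v : ℕ} .{{_ : NonZero v}} where

  infixl 6 _⊕_

  0ᵥ : Fin v
  0ᵥ = 0 mod v

  _⊕_ : Fin v → Fin v → Fin v
  x ⊕ y = (toℕ x + toℕ y) mod v

  ⊝_ : Fin v → Fin v
  ⊝ x = (v ∸ toℕ x) mod v

  sumᵥ : List (Fin v) → Fin v
  sumᵥ = foldr _⊕_ 0ᵥ

  record IsSubgroup (J : Subset v) : Set where
    field
      0∈        : 0ᵥ ∈ J
      ⊕-closed  : ∀ {x y} → x ∈ J → y ∈ J → x ⊕ y ∈ J
      ⊝-closed  : ∀ {x} → x ∈ J → ⊝ x ∈ J

-- The integer in ±{1, …, ⌊v/2⌋} representing a residue class mod v. The two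
-- classes for which this is not well determined, 0 (sent to 0) and, for even v,
-- v/2 (sent to v/2), do not matter for Heffter arrays: both lie in J, whereas
-- the n k filled cells are used up by the n k pairs {x, -x} outside J.
symmetricRep : ∀ {v} → Fin v → ℤ
symmetricRep {v} x = if toℕ x ≤ᵇ ⌊ v /2⌋ then + toℕ x else toℕ x ⊖ v

sumℤ : List ℤ → ℤ
sumℤ = foldr ℤ._+_ 0ℤ

PFArray : ℕ → ℕ → Set → Set
PFArray m n X = Fin m → Fin n → Maybe X

-- The entries in the filled cells of a row or a column.
row : ∀ {m n X} → PFArray m n X → Fin m → List X
row A i = catMaybes (tabulate (λ j → A i j))

column : ∀ {m n X} → PFArray m n X → Fin n → List X
column A j = catMaybes (tabulate (λ i → A i j))

_appearsIn_ : ∀ {m n X} → X → PFArray m n X → Set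
x appearsIn A = ∃₂ λ i j → A i j ≡ just x

modulus : (n k t : ℕ) → ℕ
modulus n k t = 2 * n * k + t

modulus-nonZero : ∀ n k t .{{_ : NonZero t}} → NonZero (modulus n k t)
modulus-nonZero n k t =
  >-nonZero (≤-trans (>-nonZero⁻¹ t) (m≤n+m t (2 * n * k)))

module _ (n k t : ℕ) .{{_ : NonZero t}} where

  private
    instance
      nonZero-v : NonZero (modulus n k t)
      nonZero-v = modulus-nonZero n k t

  record IsHeffterArray (J : Subset (modulus n k t))
                        (A : PFArray n n (Fin (modulus n k t))) : Set where
    field
      row-filled    : ∀ i → length (row A i) ≡ k
      column-filled : ∀ j → length (column A j) ≡ k
      covers        : ∀ x → x ∉ J → x appearsIn A ⊎ (⊝ x) appearsIn A
      row-sum       : ∀ i → sumᵥ (row A i) ≡ 0ᵥ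
      column-sum    : ∀ j → sumᵥ (column A j) ≡ 0ᵥ

  record IsIntegerHeffterArray (J : Subset (modulus n k t))
                               (A : PFArray n n (Fin (modulus n k t))) : Set where
    field
      isHeffterArray : IsHeffterArray J A
      row-sumℤ       : ∀ i → sumℤ (map symmetricRep (row A i)) ≡ 0ℤ
      column-sumℤ    : ∀ j → sumℤ (map symmetricRep (column A j)) ≡ 0ℤ

{-# OPTIONS --safe #-}

-- Write s = v / t = 2nk / t + 1 and N(x) = min(x, v - x) for the absolute value of the representative
-- of x. By counting, the entries, their negatives and J (the multiples of s) exhaust ℤ_v without
-- repetition, so Σ_{x ∈ ℤ_v} N(x) = 2 W + s Σ_{i ∈ ℤ_t} min(i, t - i), where W is the sum of N over the
-- entries. The rows sum to 0 in ℤ, so W is even; as Σ_{x ∈ ℤ_v} N(x) = ⌊v² / 4⌋, this reads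
-- ⌊v² / 4⌋ ≡ s ⌊t² / 4⌋ (mod 4), and (1) and (3) follow from the parities of s and t. In (2), s = 2, so
-- all entries are odd and every row sum has the parity of k.

module Submission where

open import Defs
open import Data.Bool using (true; false)
open import Data.Fin using (Fin; zero; suc; toℕ)
open import Data.Fin.Properties using (toℕ<n; toℕ≤n; toℕ-fromℕ<; toℕ-injective; suc-injective)
open import Data.Fin.Subset using (Subset; ∣_∣; inside; outside) renaming (_∈_ to _∈ₛ_; _∉_ to _∉ₛ_)
open import Data.Fin.Subset.Properties using (_∈?_)
open import Data.Integer as ℤ using (ℤ; +_; -[1+_]; -_; 0ℤ; 1ℤ)
import Data.Integer.Divisibility.Signed as ℤ
import Data.Integer.Properties as ℤ
import Data.Integer.Tactic.RingSolver as ℤ-Solver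
open import Data.List
  using (List; []; _∷_; _++_; map; length; concat; tabulate; upTo; applyUpTo; allFin; catMaybes)
open import Data.List.Membership.Propositional using (_∈_; _∉_)
open import Data.List.Membership.Propositional.Properties
  using (∈-∃++; ∈-++⁺ˡ; ∈-++⁺ʳ; ∈-map⁺; ∈-map⁻; ∈-concat⁺′; ∈-tabulate⁺; ∈-applyUpTo⁺; ∈-upTo⁺)
open import Data.List.Properties
  using (length-++; length-map; length-applyUpTo; length-upTo; length-tabulate; map-++; map-∘;
         map-cong; map-applyUpTo; applyUpTo-∷ʳ; map-upTo)
open import Data.List.Relation.Binary.Permutation.Propositional
  using (_↭_; ↭-refl; ↭-sym; ↭-trans; prep; ↭⇒↭ₛ)
open import Data.List.Relation.Binary.Permutation.Propositional.Properties
  using (shift; ↭-length; ∈-resp-↭)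
  renaming (map⁺ to ↭-map⁺)
open import Data.List.Relation.Binary.Permutation.Setoid.Properties using (Unique-resp-↭)
open import Data.List.Relation.Binary.Subset.Propositional using (_⊆_)
open import Data.List.Relation.Unary.All as All using (All; []; _∷_)
open import Data.List.Relation.Unary.AllPairs using ([]; _∷_)
open import Data.List.Relation.Unary.Any using (here; there)
open import Data.List.Relation.Unary.Unique.Propositional using (Unique)
open import Data.List.Relation.Unary.Unique.Propositional.Properties
  using (allFin⁺)
  renaming (map⁺ to Unique-map⁺)
open import Data.Maybe using (Maybe; just; nothing)
open import Data.Nat
  using (ℕ; zero; suc; _+_; _*_; _∸_; _⊓_; _≤_; _<_; _≤ᵇ_; z≤n; s≤s; s≤s⁻¹; ⌊_/2⌋; ⌈_/2⌉; NonZero;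
         ≢-nonZero; ≢-nonZero⁻¹)
open import Data.Nat.DivMod using (_%_; _/_; m≡m%n+[m/n]*n; m%n<n; [m+kn]%n≡m%n; m<n⇒m%n≡m; n%n≡0)
open import Data.Nat.Divisibility
  using (_∣_; divides; ∣m∣n⇒∣m+n; ∣m+n∣m⇒∣n; ∣1⇒≡1; *-cancelʳ-∣; ∣m⇒∣m*n; ∣n⇒∣m*n; *-pres-∣;
         *-monoˡ-∣; _∣0; n∣m*n)
open import Data.Nat.ListAction using (sum)
open import Data.Nat.ListAction.Properties using (sum-++; sum-↭)
open import Data.Nat.Primality using (euclidsLemma; prime[2])
open import Data.Nat.Properties hiding (suc-injective)
open import Data.Nat.Tactic.RingSolver using (solve-∀)
open import Data.Product using (_×_; ∃; _,_; uncurry)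
open import Data.Sum using (_⊎_; inj₁; inj₂; [_,_]′)
open import Data.Vec using ([]; _∷_; here; there)
open import Function using (_∘_; id)
open import Relation.Binary.PropositionalEquality
open import Relation.Nullary using (¬_; yes; no; contradiction; ofʸ; ofⁿ)

-- Finite lists: counting and permutations.

-- Pigeonhole principle: delete the occurrence of `x` from `ys`; the tail of `xs` still lies in what
-- remains, because `x` does not recur in it, and the length bound survives. Every counting argument
-- below goes through this.
unique∧⊆∧length⇒↭ : ∀ {A : Set} {xs ys : List A} → Unique xs → xs ⊆ ys → length ys ≤ length xs → xs ↭ ys
unique∧⊆∧length⇒↭ {xs = []}     {[]} _ _ _ = ↭-refl
unique∧⊆∧length⇒↭ {xs = x ∷ xs} (x∉xs ∷ xs!) xs⊆ys len with as , bs , refl ← ∈-∃++ (xs⊆ys (here refl)) =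
  ↭-trans (prep x (unique∧⊆∧length⇒↭ xs! xs⊆as++bs (s≤s⁻¹ len′))) (↭-sym (shift x as bs))
  where
  xs⊆as++bs : xs ⊆ as ++ bs
  xs⊆as++bs z∈xs with ∈-resp-↭ (shift x as bs) (xs⊆ys (there z∈xs))
  ... | here z≡x = contradiction (sym z≡x) (All.lookup x∉xs z∈xs)
  ... | there z∈ = z∈

  len′ : suc (length (as ++ bs)) ≤ suc (length xs)
  len′ = subst (_≤ suc (length xs)) (↭-length (shift x as bs)) len

unique-++⇒disjoint : ∀ {A : Set} (xs : List A) {ys x} → Unique (xs ++ ys) → x ∈ xs → x ∉ ys
unique-++⇒disjoint (_ ∷ xs) (x∉ ∷ _) (here refl) x∈ys = All.lookup x∉ (∈-++⁺ʳ xs x∈ys) refl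
unique-++⇒disjoint (_ ∷ xs) (_ ∷ u)  (there x∈)  x∈ys = unique-++⇒disjoint xs u x∈ x∈ys

∈-catMaybes⁺ : ∀ {A : Set} {x : A} {ms : List (Maybe A)} → just x ∈ ms → x ∈ catMaybes ms
∈-catMaybes⁺ {ms = just _  ∷ _} (here refl) = here refl
∈-catMaybes⁺ {ms = just _  ∷ _} (there x∈)  = there (∈-catMaybes⁺ x∈)
∈-catMaybes⁺ {ms = nothing ∷ _} (there x∈)  = ∈-catMaybes⁺ x∈

length-concat-tabulate : ∀ {A : Set} {n k} (f : Fin n → List A) → (∀ i → length (f i) ≡ k) →
  length (concat (tabulate f)) ≡ n * k
length-concat-tabulate {n = zero}  f len = refl
length-concat-tabulate {n = suc n} f len =
  trans (length-++ (f zero)) (cong₂ _+_ (len zero) (length-concat-tabulate (f ∘ suc) (len ∘ suc)))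

∣sum-concat-tabulate : ∀ {A : Set} {n d} (g : A → ℕ) (f : Fin n → List A) → (∀ i → d ∣ sum (map g (f i))) →
  d ∣ sum (map g (concat (tabulate f)))
∣sum-concat-tabulate {n = zero}  {d} g f d∣ = d ∣0
∣sum-concat-tabulate {n = suc n} {d} g f d∣ =
  subst (d ∣_) (sym (trans (cong sum (map-++ g (f zero) _)) (sum-++ (map g (f zero)) _)))
    (∣m∣n⇒∣m+n (d∣ zero) (∣sum-concat-tabulate g (f ∘ suc) (d∣ ∘ suc)))

-- Subsets as repetition-free lists.

elements : ∀ {n} → Subset n → List (Fin n)
elements []            = []
elements (inside  ∷ p) = zero ∷ map suc (elements p)
elements (outside ∷ p) = map suc (elements p)

length-elements : ∀ {n} (p : Subset n) → length (elements p) ≡ ∣ p ∣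
length-elements []            = refl
length-elements (inside  ∷ p) = cong suc (trans (length-map suc (elements p)) (length-elements p))
length-elements (outside ∷ p) = trans (length-map suc (elements p)) (length-elements p)

∈-elements⁺ : ∀ {n} {p : Subset n} {x} → x ∈ₛ p → x ∈ elements p
∈-elements⁺ here                              = here refl
∈-elements⁺ {p = inside  ∷ _} (there x∈p) = there (∈-map⁺ suc (∈-elements⁺ x∈p))
∈-elements⁺ {p = outside ∷ _} (there x∈p) = ∈-map⁺ suc (∈-elements⁺ x∈p)

∈-elements⁻ : ∀ {n} (p : Subset n) {x} → x ∈ elements p → x ∈ₛ p
∈-elements⁻ (inside  ∷ p) (here refl) = here
∈-elements⁻ (inside  ∷ p) (there x∈) with _ , y∈ , refl ← ∈-map⁻ suc x∈ = there (∈-elements⁻ p y∈)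
∈-elements⁻ (outside ∷ p) x∈         with _ , y∈ , refl ← ∈-map⁻ suc x∈ = there (∈-elements⁻ p y∈)

elements! : ∀ {n} (p : Subset n) → Unique (elements p)
elements! []            = []
elements! (inside  ∷ p) = All.tabulate 0≢ ∷ Unique-map⁺ suc-injective (elements! p)
  where
  0≢ : ∀ {x} → x ∈ map suc (elements p) → zero ≢ x
  0≢ x∈ 0≡x with _ , _ , refl ← ∈-map⁻ suc x∈ with () ← 0≡x
elements! (outside ∷ p) = Unique-map⁺ suc-injective (elements! p)

toℕ-allFin-↭ : ∀ n → map toℕ (allFin n) ↭ upTo n
toℕ-allFin-↭ n = unique∧⊆∧length⇒↭ (Unique-map⁺ toℕ-injective (allFin⁺ n)) ⊆upTo
  (≤-reflexive (trans (length-upTo n) (sym (trans (length-map toℕ (allFin n)) (length-tabulate {n = n} (λ i → i))))))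
  where
  ⊆upTo : map toℕ (allFin n) ⊆ upTo n
  ⊆upTo x∈ with i , _ , refl ← ∈-map⁻ toℕ x∈ = ∈-upTo⁺ (toℕ<n i)

-- Arithmetic in ℤ_v and its subgroups.

module _ {v : ℕ} .{{_ : NonZero v}} where

  toℕ-⊕ : ∀ (x y : Fin v) → toℕ x + toℕ y ≡ toℕ (x ⊕ y) + (toℕ x + toℕ y) / v * v
  toℕ-⊕ x y = trans (m≡m%n+[m/n]*n (toℕ x + toℕ y) v)
    (cong (_+ (toℕ x + toℕ y) / v * v) (sym (toℕ-fromℕ< (m%n<n (toℕ x + toℕ y) v))))

  -- The sums are lifted to ℕ with their quotients by `v`. Adding to each side the multiple of `v`
  -- discarded on the other equates them without subtraction; `toℕ x` then cancels and reduction mod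
  -- `v` removes the multiples.
  ⊕-cancelˡ : ∀ (x : Fin v) {y z} → x ⊕ y ≡ x ⊕ z → y ≡ z
  ⊕-cancelˡ x {y} {z} eq = toℕ-injective (begin
    toℕ y                    ≡⟨ m<n⇒m%n≡m (toℕ<n y) ⟨
    toℕ y % v                ≡⟨ [m+kn]%n≡m%n (toℕ y) q′ v ⟨
    (toℕ y + q′ * v) % v     ≡⟨ cong (_% v) (+-cancelˡ-≡ (toℕ x) _ _ lifted) ⟩
    (toℕ z + q * v) % v      ≡⟨ [m+kn]%n≡m%n (toℕ z) q v ⟩
    toℕ z % v                ≡⟨ m<n⇒m%n≡m (toℕ<n z) ⟩
    toℕ z                    ∎)
    where
    open ≡-Reasoning
    q  = (toℕ x + toℕ y) / v
    q′ = (toℕ x + toℕ z) / v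
    r  = toℕ (x ⊕ z)
    lifted : toℕ x + (toℕ y + q′ * v) ≡ toℕ x + (toℕ z + q * v)
    lifted = begin
      toℕ x + (toℕ y + q′ * v)   ≡⟨ +-assoc (toℕ x) (toℕ y) _ ⟨
      toℕ x + toℕ y + q′ * v     ≡⟨ cong (_+ q′ * v) (toℕ-⊕ x y) ⟩
      toℕ (x ⊕ y) + q * v + q′ * v ≡⟨ cong (λ w → toℕ w + q * v + q′ * v) eq ⟩
      r + q * v + q′ * v         ≡⟨ +-assoc r (q * v) (q′ * v) ⟩
      r + (q * v + q′ * v)       ≡⟨ cong (_+_ r) (+-comm (q * v) (q′ * v)) ⟩
      r + (q′ * v + q * v)       ≡⟨ +-assoc r (q′ * v) (q * v) ⟨
      r + q′ * v + q * v         ≡⟨ cong (_+ q * v) (toℕ-⊕ x z) ⟨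
      toℕ x + toℕ z + q * v      ≡⟨ +-assoc (toℕ x) (toℕ z) _ ⟩
      toℕ x + (toℕ z + q * v)    ∎

  ⊝-involutive : ∀ (x : Fin v) → ⊝ (⊝ x) ≡ x
  ⊝-involutive x = toℕ-injective (begin
    toℕ (⊝ (⊝ x))                ≡⟨ toℕ-fromℕ< (m%n<n (v ∸ toℕ (⊝ x)) v) ⟩
    (v ∸ toℕ (⊝ x)) % v          ≡⟨ cong (λ m → (v ∸ m) % v) (toℕ-fromℕ< (m%n<n (v ∸ toℕ x) v)) ⟩
    (v ∸ (v ∸ toℕ x) % v) % v    ≡⟨ go (toℕ x) (toℕ<n x) ⟩
    toℕ x                        ∎)
    where
    open ≡-Reasoning
    go : ∀ m → m < v → (v ∸ (v ∸ m) % v) % v ≡ m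
    -- Zero is separate: `v ∸ 0` is `v` itself, which the remainder sends back to 0, whereas for
    -- positive `m` the difference is already below `v`.
    go zero    _     = trans (cong (λ m → (v ∸ m) % v) (n%n≡0 v)) (n%n≡0 v)
    go (suc m) 1+m<v = begin
      (v ∸ (v ∸ suc m) % v) % v  ≡⟨ cong (λ d → (v ∸ d) % v) (m<n⇒m%n≡m (∸-monoʳ-< (s≤s z≤n) (<⇒≤ 1+m<v))) ⟩
      (v ∸ (v ∸ suc m)) % v      ≡⟨ cong (_% v) (m∸[m∸n]≡n (<⇒≤ 1+m<v)) ⟩
      suc m % v                  ≡⟨ m<n⇒m%n≡m 1+m<v ⟩
      suc m                      ∎

  -- `w` collects the quotients by `v` discarded by the individual additions; only its existence
  -- matters.
  sum-translate : ∀ (x : Fin v) ys → ∃ λ w →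
    length ys * toℕ x + sum (map toℕ ys) ≡ sum (map toℕ (map (x ⊕_) ys)) + w * v
  sum-translate x []       = 0 , refl
  sum-translate x (y ∷ ys) with w , eq ← sum-translate x ys = q + w , (begin
    (toℕ x + l * toℕ x) + (toℕ y + S)  ≡⟨ swap (toℕ x) (l * toℕ x) (toℕ y) S ⟩
    (toℕ x + toℕ y) + (l * toℕ x + S)  ≡⟨ cong₂ _+_ (toℕ-⊕ x y) eq ⟩
    (toℕ (x ⊕ y) + q * v) + (T + w * v) ≡⟨ regroup (toℕ (x ⊕ y)) q v T w ⟩
    (toℕ (x ⊕ y) + T) + (q + w) * v    ∎)
    where
    open ≡-Reasoning
    l = length ys
    S = sum (map toℕ ys)
    T = sum (map toℕ (map (x ⊕_) ys))
    q = (toℕ x + toℕ y) / v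
    swap : ∀ a b c d → (a + b) + (c + d) ≡ (a + c) + (b + d)
    swap = solve-∀
    regroup : ∀ a q v T w → (a + q * v) + (T + w * v) ≡ (a + T) + (q + w) * v
    regroup = solve-∀

  -- Lagrange's theorem for J: translation by x permutes J, so summing J in two ways gives |J| x = 0.
  ∣J∣*x≡0 : ∀ {J : Subset v} → IsSubgroup J → ∀ {x} → x ∈ₛ J → v ∣ ∣ J ∣ * toℕ x
  ∣J∣*x≡0 {J} isSubgroup {x} x∈J with w , eq ← sum-translate x (elements J) =
    divides w (trans (cong (_* toℕ x) (sym (length-elements J)))
      (+-cancelʳ-≡ S _ _ (trans eq (trans (cong (_+ w * v) (sum-↭ (↭-map⁺ toℕ x⊕J↭J))) (+-comm S (w * v))))))
    where
    S = sum (map toℕ (elements J))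
    x⊕J⊆J : map (x ⊕_) (elements J) ⊆ elements J
    x⊕J⊆J z∈ with y , y∈ , refl ← ∈-map⁻ (x ⊕_) z∈ =
      ∈-elements⁺ (IsSubgroup.⊕-closed isSubgroup x∈J (∈-elements⁻ J y∈))
    x⊕J↭J : map (x ⊕_) (elements J) ↭ elements J
    x⊕J↭J = unique∧⊆∧length⇒↭ (Unique-map⁺ (⊕-cancelˡ x) (elements! J)) x⊕J⊆J
      (≤-reflexive (sym (length-map (x ⊕_) (elements J))))

  -- With t = `∣ J ∣`, Lagrange gives that s t divides t x, so x = i s, and x < v forces i < t. Thus
  -- `J` lies among t multiples of `s`, and having t elements it exhausts them.
  subgroup-multiples : ∀ {J : Subset v} {s} → IsSubgroup J → v ≡ s * ∣ J ∣ →
    map toℕ (elements J) ↭ applyUpTo (_* s) ∣ J ∣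
  subgroup-multiples {J} {s} isSubgroup v≡ = unique∧⊆∧length⇒↭ (Unique-map⁺ toℕ-injective (elements! J)) J⊆
    (≤-reflexive (trans (length-applyUpTo (_* s) ∣ J ∣) (sym (trans (length-map toℕ (elements J)) (length-elements J)))))
    where
    J⊆ : map toℕ (elements J) ⊆ applyUpTo (_* s) ∣ J ∣
    J⊆ z∈
      with x , x∈ , refl ← ∈-map⁻ toℕ z∈
      with divides i eq ← ∣J∣*x≡0 isSubgroup (∈-elements⁻ J x∈) =
      subst (_∈ applyUpTo (_* s) t) (sym x≡is) (∈-applyUpTo⁺ (_* s) i<t)
      where
      t = ∣ J ∣
      t≢0 : t ≢ 0
      t≢0 t≡0 = ≢-nonZero⁻¹ v (trans v≡ (trans (cong (s *_) t≡0) (*-zeroʳ s)))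
      x≡is : toℕ x ≡ i * s
      x≡is = *-cancelˡ-≡ (toℕ x) (i * s) t {{≢-nonZero t≢0}} (trans eq (trans (cong (i *_) v≡) (rearrange i s t)))
        where
        rearrange : ∀ i s t → i * (s * t) ≡ t * (i * s)
        rearrange = solve-∀
      i<t : i < t
      i<t = *-cancelʳ-< s i t (subst₂ _<_ x≡is (trans v≡ (*-comm s t)) (toℕ<n x))

-- Absolute values of residues and their totals.

-- For x ≤ v, the distance from x to the nearest multiple of v. It is kept on naturals rather than
-- on `Fin v` so that the modulus can vary by recursion and by scaling.
norm : ℕ → ℕ → ℕ
norm v x = x ⊓ (v ∸ x)

∣symmetricRep∣ : ∀ {v} (x : Fin v) → ℤ.∣ symmetricRep x ∣ ≡ norm v (toℕ x)
∣symmetricRep∣ {v} x with toℕ x ≤ᵇ ⌊ v /2⌋ | ≤ᵇ-reflects-≤ (toℕ x) ⌊ v /2⌋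
... | true | ofʸ x≤ = sym (m≤n⇒m⊓n≡m (m+n≤o⇒m≤o∸n (toℕ x) (begin
  toℕ x + toℕ x       ≤⟨ +-mono-≤ x≤ (≤-trans x≤ (⌊n/2⌋≤⌈n/2⌉ v)) ⟩
  ⌊ v /2⌋ + ⌈ v /2⌉   ≡⟨ ⌊n/2⌋+⌈n/2⌉≡n v ⟩
  v                   ∎)))
  where open ≤-Reasoning
... | false | ofⁿ x≰ = trans (ℤ.∣⊖∣-≤ (toℕ≤n x)) (sym (m≥n⇒m⊓n≡n (m≤n+o⇒m∸n≤o v (toℕ x) (begin
  v                   ≡⟨ ⌊n/2⌋+⌈n/2⌉≡n v ⟨
  -- The strict inequality absorbs the rounding: `⌈ v /2⌉` is `⌊ suc v /2⌋`, at most `suc ⌊ v /2⌋`,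
  -- which is at most `toℕ x`.
  ⌊ v /2⌋ + ⌈ v /2⌉   ≤⟨ +-mono-≤ (<⇒≤ (≰⇒> x≰)) (≤-trans (⌊n/2⌋-mono (n≤1+n (suc v))) (≰⇒> x≰)) ⟩
  toℕ x + toℕ x       ∎))))
  where open ≤-Reasoning

norm-⊝ : ∀ {v} .{{_ : NonZero v}} (x : Fin v) → norm v (toℕ (⊝ x)) ≡ norm v (toℕ x)
norm-⊝ {v} x = trans (cong (norm v) (toℕ-fromℕ< (m%n<n (v ∸ toℕ x) v))) (go (toℕ x) (toℕ≤n x))
  where
  go : ∀ m → m ≤ v → norm v ((v ∸ m) % v) ≡ norm v m
  go zero    _   = cong (norm v) (n%n≡0 v)
  go (suc m) m<v = begin
    norm v ((v ∸ suc m) % v)            ≡⟨ cong (norm v) (m<n⇒m%n≡m (∸-monoʳ-< (s≤s z≤n) m<v)) ⟩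
    (v ∸ suc m) ⊓ (v ∸ (v ∸ suc m))     ≡⟨ cong ((v ∸ suc m) ⊓_) (m∸[m∸n]≡n m<v) ⟩
    (v ∸ suc m) ⊓ suc m                 ≡⟨ ⊓-comm (v ∸ suc m) (suc m) ⟩
    norm v (suc m)                      ∎
    where open ≡-Reasoning

totalNorm : ℕ → ℕ
totalNorm v = sum (applyUpTo (norm v) v)

sum-applyUpTo-cong : ∀ {f g : ℕ → ℕ} n → (∀ {i} → i < n → f i ≡ g i) →
  sum (applyUpTo f n) ≡ sum (applyUpTo g n)
sum-applyUpTo-cong zero    f≗g = refl
sum-applyUpTo-cong (suc n) f≗g = cong₂ _+_ (f≗g (s≤s z≤n)) (sum-applyUpTo-cong n (f≗g ∘ s≤s))

sum-applyUpTo-suc : ∀ (f : ℕ → ℕ) n → sum (applyUpTo (suc ∘ f) n) ≡ n + sum (applyUpTo f n)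
sum-applyUpTo-suc f zero    = refl
sum-applyUpTo-suc f (suc n) = cong suc (begin
  f 0 + sum (applyUpTo (suc ∘ f ∘ suc) n)  ≡⟨ cong (_+_ (f 0)) (sum-applyUpTo-suc (f ∘ suc) n) ⟩
  f 0 + (n + S)                            ≡⟨ +-assoc (f 0) n S ⟨
  f 0 + n + S                              ≡⟨ cong (_+ S) (+-comm (f 0) n) ⟩
  n + f 0 + S                              ≡⟨ +-assoc n (f 0) S ⟩
  n + (f 0 + S)                            ∎)
  where
  open ≡-Reasoning
  S = sum (applyUpTo (f ∘ suc) n)

sum-applyUpTo-∷ʳ : ∀ (f : ℕ → ℕ) n → sum (applyUpTo f (suc n)) ≡ sum (applyUpTo f n) + f n
sum-applyUpTo-∷ʳ f n = begin
  sum (applyUpTo f (suc n))          ≡⟨ cong sum (applyUpTo-∷ʳ f n) ⟨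
  sum (applyUpTo f n ++ f n ∷ [])    ≡⟨ sum-++ (applyUpTo f n) _ ⟩
  sum (applyUpTo f n) + (f n + 0)    ≡⟨ cong (_+_ (sum (applyUpTo f n))) (+-identityʳ (f n)) ⟩
  sum (applyUpTo f n) + f n          ∎
  where open ≡-Reasoning

sum-applyUpTo-* : ∀ (f : ℕ → ℕ) s n → sum (applyUpTo (λ i → f i * s) n) ≡ sum (applyUpTo f n) * s
sum-applyUpTo-* f s zero    = refl
sum-applyUpTo-* f s (suc n) = trans (cong (_+_ (f 0 * s)) (sum-applyUpTo-* (f ∘ suc) s n)) (sym (*-distribʳ-+ s (f 0) _))

-- From modulus n to n + 2, a zero appears in front and each of the n + 1 values at 0, ..., n,
-- shifted by one place, grows by 1. This gives closed forms by induction in steps of two.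
totalNorm-step : ∀ n → totalNorm (2 + n) ≡ suc n + totalNorm n
totalNorm-step n = begin
  sum (applyUpTo (λ i → suc i ⊓ (suc n ∸ i)) (suc n))
    -- Since i ≤ n, the truncated `suc n ∸ i` is a successor, and the minimum of two successors
    -- computes to `suc (norm n i)`.
    ≡⟨ sum-applyUpTo-cong (suc n) (λ {i} i≤n → cong (suc i ⊓_) (+-∸-assoc 1 (s≤s⁻¹ i≤n))) ⟩
  sum (applyUpTo (suc ∘ norm n) (suc n))          ≡⟨ sum-applyUpTo-suc (norm n) (suc n) ⟩
  -- The range has one index more than `totalNorm n`, namely n, where the norm is 0.
  suc n + sum (applyUpTo (norm n) (suc n))        ≡⟨ cong (_+_ (suc n)) (sum-applyUpTo-∷ʳ (norm n) n) ⟩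
  suc n + (totalNorm n + n ⊓ (n ∸ n))             ≡⟨ cong (λ d → suc n + (totalNorm n + n ⊓ d)) (n∸n≡0 n) ⟩
  suc n + (totalNorm n + n ⊓ 0)                   ≡⟨ cong (λ d → suc n + (totalNorm n + d)) (⊓-zeroʳ n) ⟩
  suc n + (totalNorm n + 0)                       ≡⟨ cong (_+_ (suc n)) (+-identityʳ _) ⟩
  suc n + totalNorm n                             ∎
  where open ≡-Reasoning

-- The increments are the first `u` odd numbers.
totalNorm-even : ∀ u → totalNorm (u * 2) ≡ u * u
totalNorm-even zero    = refl
totalNorm-even (suc u) = trans (totalNorm-step (u * 2)) (trans (cong (_+_ (suc (u * 2))) (totalNorm-even u)) (square u))
  where
  square : ∀ u → suc (u * 2) + u * u ≡ suc u * suc u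
  square = solve-∀

-- The increments are the first `u` positive even numbers.
totalNorm-odd : ∀ u → totalNorm (suc (u * 2)) ≡ u * suc u
totalNorm-odd zero    = refl
totalNorm-odd (suc u) = trans (totalNorm-step (suc (u * 2))) (trans (cong (_+_ (suc (suc (u * 2)))) (totalNorm-odd u)) (pronic u))
  where
  pronic : ∀ u → suc (suc (u * 2)) + u * suc u ≡ suc u * suc (suc u)
  pronic = solve-∀

-- Multiplication by `s` distributes over minimum and truncated subtraction, so the norm scales with
-- the modulus.
totalNorm-multiples : ∀ s t → sum (applyUpTo (λ i → norm (t * s) (i * s)) t) ≡ totalNorm t * s
totalNorm-multiples s t = trans (sum-applyUpTo-cong t (λ {i} _ → sym (norm-* i))) (sum-applyUpTo-* (norm t) s t)
  where
  norm-* : ∀ i → norm t i * s ≡ norm (t * s) (i * s)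
  norm-* i = trans (*-distribʳ-⊓ s i (t ∸ i)) (cong (i * s ⊓_) (*-distribʳ-∸ s t i))

-- Parity and divisibility by 4.

∣∣-parity : ∀ z → ∃ λ w → + ℤ.∣ z ∣ ≡ z ℤ.+ w ℤ.* + 2
∣∣-parity (+ m)      = 0ℤ , sym (ℤ.+-identityʳ (+ m))
∣∣-parity -[1+ m ]   = + suc m , double (+ suc m)
  where
  double : ∀ a → a ≡ - a ℤ.+ a ℤ.* + 2
  double = ℤ-Solver.solve-∀

sum-∣∣-parity : ∀ zs → ∃ λ w → + sum (map ℤ.∣_∣ zs) ≡ sumℤ zs ℤ.+ w ℤ.* + 2
sum-∣∣-parity []       = 0ℤ , refl
sum-∣∣-parity (z ∷ zs) with w , eq ← sum-∣∣-parity zs with w′ , eq′ ← ∣∣-parity z =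
  w′ ℤ.+ w , trans (cong₂ ℤ._+_ eq′ eq) (regroup z w′ (sumℤ zs) w)
  where
  regroup : ∀ z w′ S w → (z ℤ.+ w′ ℤ.* + 2) ℤ.+ (S ℤ.+ w ℤ.* + 2) ≡ (z ℤ.+ S) ℤ.+ (w′ ℤ.+ w) ℤ.* + 2
  regroup = ℤ-Solver.solve-∀

-- An integer and its absolute value have the same parity, so the sum of absolute values has the
-- parity of the signed sum. This is where the condition over ℤ, rather than mod v, enters.
sumℤ≡0⇒2∣sum-∣∣ : ∀ zs → sumℤ zs ≡ 0ℤ → 2 ∣ sum (map ℤ.∣_∣ zs)
sumℤ≡0⇒2∣sum-∣∣ zs sum≡0 with w , eq ← sum-∣∣-parity zs =
  ℤ.∣⇒∣ᵤ (ℤ.divides w (trans eq (trans (cong (ℤ._+ w ℤ.* + 2) sum≡0) (ℤ.+-identityˡ _))))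

-- Oddness of m is encoded as `2 ∣ suc m`; the extra ones add up to the length.
odd-summands : ∀ ms → All (λ m → 2 ∣ suc m) ms → 2 ∣ sum ms + length ms
odd-summands []       []           = 2 ∣0
odd-summands (m ∷ ms) (odd ∷ odds) =
  subst (2 ∣_) (regroup m (sum ms) (length ms)) (∣m∣n⇒∣m+n odd (odd-summands ms odds))
  where
  regroup : ∀ m S l → suc m + (S + l) ≡ m + S + suc l
  regroup = solve-∀

even⊎odd : ∀ n → (∃ λ u → n ≡ u * 2) ⊎ (∃ λ u → n ≡ suc (u * 2))
even⊎odd zero    = inj₁ (0 , refl)
even⊎odd (suc n) = [ (λ (u , eq) → inj₂ (u , cong suc eq)) , (λ (u , eq) → inj₁ (suc u , cong suc eq)) ]′ (even⊎odd n)

2∤1+2u : ∀ u → ¬ 2 ∣ suc (u * 2)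
2∤1+2u u 2∣ with () ← ∣1⇒≡1 (∣m+n∣m⇒∣n {m = u * 2} (subst (2 ∣_) (+-comm 1 (u * 2)) 2∣) (n∣m*n u))

2∣odd*n⇒2∣n : ∀ u n → 2 ∣ suc (u * 2) * n → 2 ∣ n
2∣odd*n⇒2∣n u n 2∣ =
  [ (λ 2∣odd → contradiction 2∣odd (2∤1+2u u)) , id ]′ (euclidsLemma (suc (u * 2)) n prime[2] 2∣)

2∣n*n⇒2∣n : ∀ n → 2 ∣ n * n → 2 ∣ n
2∣n*n⇒2∣n n 2∣ = [ id , id ]′ (euclidsLemma n n prime[2] 2∣)

2∣n*[1+n] : ∀ n → 2 ∣ n * suc n
2∣n*[1+n] n with even⊎odd n
... | inj₁ (u , refl) = ∣m⇒∣m*n (suc (u * 2)) (n∣m*n u)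
... | inj₂ (u , refl) = ∣n⇒∣m*n (suc (u * 2)) (n∣m*n (suc u))

-- Of two consecutive numbers one is odd, so the other absorbs the whole factor 4.
4∣n*[1+n]⇒4∣n⊎4∣1+n : ∀ n → 4 ∣ n * suc n → (4 ∣ n) ⊎ (4 ∣ suc n)
4∣n*[1+n]⇒4∣n⊎4∣1+n n 4∣ with even⊎odd n
... | inj₁ (u , refl) = inj₁ (*-monoˡ-∣ 2 (2∣odd*n⇒2∣n u u (*-cancelʳ-∣ 2 (subst (4 ∣_) (regroup u) 4∣))))
  where
  regroup : ∀ u → u * 2 * suc (u * 2) ≡ suc (u * 2) * u * 2
  regroup = solve-∀
... | inj₂ (u , refl) = inj₂ (*-monoˡ-∣ 2 (2∣odd*n⇒2∣n u (suc u) (*-cancelʳ-∣ 2 (subst (4 ∣_) (regroup u) 4∣))))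
  where
  regroup : ∀ u → suc (u * 2) * (suc u * 2) ≡ suc (u * 2) * suc u * 2
  regroup = solve-∀

-- The counting identity for integer Heffter arrays.

-- The total splits along the cover: negation preserves the norm, so the entries and their negatives
-- contribute equally, and `J` contributes a scaled copy of the total for ℤ_t.
totalNorm-cover : ∀ {v s} .{{_ : NonZero v}} (xs : List (Fin v)) {J : Subset v} → IsSubgroup J → v ≡ s * ∣ J ∣ →
  allFin v ↭ xs ++ map ⊝_ xs ++ elements J →
  totalNorm v ≡ sum (map (norm v ∘ toℕ) xs) * 2 + totalNorm ∣ J ∣ * s
totalNorm-cover {v} {s} xs {J} isSubgroup v≡ cover = begin
  totalNorm v                                              ≡⟨ cong sum (map-upTo (norm v) v) ⟨
  sum (map (norm v) (upTo v))                              ≡⟨ sum-↭ (↭-map⁺ (norm v) (toℕ-allFin-↭ v)) ⟨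
  sum (map (norm v) (map toℕ (allFin v)))                  ≡⟨ cong sum (map-∘ (allFin v)) ⟨
  sum (map f (allFin v))                                   ≡⟨ sum-↭ (↭-map⁺ f cover) ⟩
  sum (map f (xs ++ map ⊝_ xs ++ elements J))              ≡⟨ sum-map-++ xs _ ⟩
  W + sum (map f (map ⊝_ xs ++ elements J))                ≡⟨ cong (_+_ W) (sum-map-++ (map ⊝_ xs) _) ⟩
  W + (sum (map f (map ⊝_ xs)) + sum (map f (elements J))) ≡⟨ cong₂ (λ a b → W + (a + b)) sum-⊝ sum-J ⟩
  W + (W + totalNorm t * s)                                ≡⟨ regroup W (totalNorm t * s) ⟩
  W * 2 + totalNorm t * s                                  ∎
  where
  open ≡-Reasoning
  t = ∣ J ∣
  f = norm v ∘ toℕ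
  W = sum (map f xs)
  regroup : ∀ a b → a + (a + b) ≡ a * 2 + b
  regroup = solve-∀
  sum-map-++ : ∀ ys zs → sum (map f (ys ++ zs)) ≡ sum (map f ys) + sum (map f zs)
  sum-map-++ ys zs = trans (cong sum (map-++ f ys zs)) (sum-++ (map f ys) (map f zs))
  sum-⊝ : sum (map f (map ⊝_ xs)) ≡ W
  sum-⊝ = cong sum (trans (sym (map-∘ xs)) (map-cong norm-⊝ xs))
  sum-J : sum (map f (elements J)) ≡ totalNorm t * s
  sum-J = begin
    sum (map f (elements J))                       ≡⟨ cong sum (map-∘ (elements J)) ⟩
    sum (map (norm v) (map toℕ (elements J)))      ≡⟨ sum-↭ (↭-map⁺ (norm v) (subgroup-multiples isSubgroup v≡)) ⟩
    sum (map (norm v) (applyUpTo (_* s) t))        ≡⟨ cong sum (map-applyUpTo (_* s) (norm v) t) ⟩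
    sum (applyUpTo (λ i → norm v (i * s)) t)       ≡⟨ cong (λ m → sum (applyUpTo (λ i → norm m (i * s)) t)) (trans v≡ (*-comm s t)) ⟩
    sum (applyUpTo (λ i → norm (t * s) (i * s)) t) ≡⟨ totalNorm-multiples s t ⟩
    totalNorm t * s                                ∎

module _ {n k t : ℕ} .{{_ : NonZero t}} {J : Subset (modulus n k t)} {A : PFArray n n (Fin (modulus n k t))}
  (isSubgroup : IsSubgroup {{modulus-nonZero n k t}} J) (∣J∣≡t : ∣ J ∣ ≡ t)
  (integerHeffter : IsIntegerHeffterArray n k t J A)
  where

  private
    v = modulus n k t
    instance
      nonZero-v : NonZero v
      nonZero-v = modulus-nonZero n k t

  open IsIntegerHeffterArray integerHeffter
  open IsHeffterArray isHeffterArray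

  entries : List (Fin v)
  entries = concat (tabulate (row A))

  appearsIn⇒∈entries : ∀ {x} → x appearsIn A → x ∈ entries
  appearsIn⇒∈entries (i , j , eq) =
    ∈-concat⁺′ (∈-catMaybes⁺ (subst (_∈ tabulate (A i)) eq (∈-tabulate⁺ j))) (∈-tabulate⁺ i)

  -- The list on the right covers ℤ_v and has length nk + nk + t = v, so the covering is exact.
  -- Distinctness of the entries is thus a conclusion of the count.
  allFin-↭-entries : allFin v ↭ entries ++ map ⊝_ entries ++ elements J
  allFin-↭-entries = unique∧⊆∧length⇒↭ (allFin⁺ v) (λ {x} _ → covered x) (≤-reflexive (begin
    length (entries ++ map ⊝_ entries ++ elements J)
      ≡⟨ length-++ entries ⟩
    length entries + length (map ⊝_ entries ++ elements J)
      ≡⟨ cong (_+_ (length entries)) (length-++ (map ⊝_ entries)) ⟩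
    length entries + (length (map ⊝_ entries) + length (elements J))
      ≡⟨ cong (λ l → length entries + (l + length (elements J))) (length-map ⊝_ entries) ⟩
    length entries + (length entries + length (elements J))
      ≡⟨ cong₂ (λ l m → l + (l + m)) (length-concat-tabulate (row A) row-filled) (trans (length-elements J) ∣J∣≡t) ⟩
    n * k + (n * k + t)
      ≡⟨ regroup n k t ⟩
    v
      ≡⟨ length-tabulate {n = v} (λ i → i) ⟨
    length (allFin v) ∎))
    where
    open ≡-Reasoning
    regroup : ∀ n k t → n * k + (n * k + t) ≡ 2 * n * k + t
    regroup = solve-∀
    covered : ∀ x → x ∈ entries ++ map ⊝_ entries ++ elements J
    covered x with x ∈? J
    ... | yes x∈J = ∈-++⁺ʳ entries (∈-++⁺ʳ (map ⊝_ entries) (∈-elements⁺ x∈J))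
    ... | no  x∉J with covers x x∉J
    ...   | inj₁ x∈A  = ∈-++⁺ˡ (appearsIn⇒∈entries x∈A)
    -- Here x occurs as the negative of the entry `⊝ x`.
    ...   | inj₂ ⊝x∈A = ∈-++⁺ʳ entries (∈-++⁺ˡ
      (subst (_∈ map ⊝_ entries) (⊝-involutive x) (∈-map⁺ ⊝_ (appearsIn⇒∈entries ⊝x∈A))))

  -- The exact cover inherits freedom from repetition from `allFin v`, so its segments are disjoint.
  entries∉J : ∀ {x} → x ∈ entries → x ∉ₛ J
  entries∉J x∈ x∈J =
    unique-++⇒disjoint entries (Unique-resp-↭ (setoid (Fin v)) (↭⇒↭ₛ allFin-↭-entries) (allFin⁺ v)) x∈
      (∈-++⁺ʳ (map ⊝_ entries) (∈-elements⁺ x∈J))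

  2∣row-norm : ∀ i → 2 ∣ sum (map (norm v ∘ toℕ) (row A i))
  2∣row-norm i = subst (λ ms → 2 ∣ sum ms) (trans (sym (map-∘ (row A i))) (map-cong ∣symmetricRep∣ (row A i)))
    (sumℤ≡0⇒2∣sum-∣∣ (map symmetricRep (row A i)) (row-sumℤ i))

  -- Each row has even norm sum, so the norms of all entries add up to an even number; counting both
  -- signs doubles it to a multiple of 4.
  totalNorm-heffter : ∀ {s} → v ≡ s * t → ∃ λ w → totalNorm v ≡ w * 4 + totalNorm t * s
  totalNorm-heffter {s} v≡ with divides w eq ← ∣sum-concat-tabulate (norm v ∘ toℕ) (row A) 2∣row-norm =
    w , trans (totalNorm-cover entries isSubgroup (trans v≡ (cong (s *_) (sym ∣J∣≡t))) allFin-↭-entries)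
      (cong₂ _+_ (trans (cong (_* 2) eq) (*-assoc w 2 2)) (cong (λ t → totalNorm t * s) ∣J∣≡t))

  -- For index 2, `J` consists of all even residues, and the entries avoid `J`.
  entries-odd : v ≡ 2 * t → ∀ {x} → x ∈ entries → 2 ∣ suc (toℕ x)
  entries-odd v≡2t {x} x∈ with even⊎odd (toℕ x)
  ... | inj₂ (u , eq) = divides (suc u) (cong suc eq)
  ... | inj₁ (u , eq) = contradiction x∈J (entries∉J x∈)
    where
    v≡2J : v ≡ 2 * ∣ J ∣
    v≡2J = trans v≡2t (cong (2 *_) (sym ∣J∣≡t))
    2u∈ : u * 2 ∈ applyUpTo (_* 2) ∣ J ∣
    2u∈ = ∈-applyUpTo⁺ (_* 2) (*-cancelʳ-< 2 u ∣ J ∣ (subst₂ _<_ eq (trans v≡2J (*-comm 2 ∣ J ∣)) (toℕ<n x)))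
    x∈J : x ∈ₛ J
    x∈J with y , y∈J , 2u≡y ← ∈-map⁻ toℕ (∈-resp-↭ (↭-sym (subgroup-multiples isSubgroup v≡2J)) 2u∈) =
      subst (_∈ₛ J) (sym (toℕ-injective (trans eq 2u≡y))) (∈-elements⁻ J y∈J)

  -- The k norms in row `i` are all odd, yet their sum is even. The argument of type `Fin n`
  -- provides a row to look at.
  index-2⇒2∣k : v ≡ 2 * t → Fin n → 2 ∣ k
  index-2⇒2∣k v≡2t i = subst (2 ∣_) (trans (length-map f (row A i)) (row-filled i))
    (∣m+n∣m⇒∣n (odd-summands (map f (row A i)) (All.tabulate norms-odd)) (2∣row-norm i))
    where
    f = norm v ∘ toℕ
    2∣v : 2 ∣ v
    2∣v = divides t (trans v≡2t (*-comm 2 t))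
    norm-odd : ∀ x → 2 ∣ suc (toℕ x) → 2 ∣ suc (f x)
    norm-odd x odd with ⊓-sel (toℕ x) (v ∸ toℕ x)
    ... | inj₁ eq = subst (λ m → 2 ∣ suc m) (sym eq) odd
    ... | inj₂ eq = subst (λ m → 2 ∣ suc m) (sym eq)
      (∣m+n∣m⇒∣n (subst (2 ∣_) 2+v≡ (∣m∣n⇒∣m+n (divides 1 refl) 2∣v)) odd)
      where
      -- As v is even, x and v - x have the same parity; with oddness encoded through successors,
      -- the two successors add up to `2 + v`.
      2+v≡ : 2 + v ≡ suc (toℕ x) + suc (v ∸ toℕ x)
      2+v≡ = cong suc (trans (cong suc (sym (m+[n∸m]≡n (toℕ≤n x)))) (sym (+-suc (toℕ x) (v ∸ toℕ x))))
    norms-odd : ∀ {m} → m ∈ map f (row A i) → 2 ∣ suc m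
    norms-odd m∈ with x , x∈ , refl ← ∈-map⁻ f m∈ = norm-odd x (entries-odd v≡2t (∈-concat⁺′ x∈ (∈-tabulate⁺ i)))

-- Consequences for odd and for even index.

-- Here the index is s = 2q + 1, and q t is nk in the application. The closed forms for t and s t
-- are compared mod 4, using s² = s + 2qs to cancel the contribution of `J`.
odd-index : ∀ q t w → totalNorm (suc (q * 2) * t) ≡ w * 4 + totalNorm t * suc (q * 2) →
  (4 ∣ q * t) ⊎ ((4 ∣ q * t + t) × (∃ λ u → t ≡ suc (u * 2)))
odd-index q t w eq with even⊎odd t
... | inj₁ (u , refl) = inj₁ (subst (4 ∣_) (*-assoc q u 2) (*-monoˡ-∣ 2 2∣qu))
  where
  open ≡-Reasoning
  s = suc (q * 2)
  -- For t = 2u the cancellation leaves 2 s q u² = 4w, so s q u² is even. As s is odd, 2 divides q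
  -- u², hence q u, and q t = 2qu is a multiple of 4.
  2∣qu : 2 ∣ q * u
  2∣qu = [ ∣m⇒∣m*n u , ∣n⇒∣m*n q ∘ 2∣n*n⇒2∣n u ]′ (euclidsLemma q (u * u) prime[2]
    (2∣odd*n⇒2∣n q (q * (u * u)) (*-cancelʳ-∣ 2 (divides w (+-cancelʳ-≡ (u * u * s) _ _ (begin
      s * (q * (u * u)) * 2 + u * u * s      ≡⟨ square q u ⟩
      s * u * (s * u)                        ≡⟨ totalNorm-even (s * u) ⟨
      totalNorm (s * u * 2)                  ≡⟨ cong totalNorm (*-assoc s u 2) ⟩
      totalNorm (s * (u * 2))                ≡⟨ eq ⟩
      w * 4 + totalNorm (u * 2) * s          ≡⟨ cong (λ g → w * 4 + g * s) (totalNorm-even u) ⟩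
      w * 4 + u * u * s                      ∎))))))
    where
    square : ∀ q u → suc (q * 2) * (q * (u * u)) * 2 + u * u * suc (q * 2) ≡ suc (q * 2) * u * (suc (q * 2) * u)
    square = solve-∀
... | inj₂ (u , refl) =
  [ inj₁ ∘ ∣m⇒∣m*n t
  , (λ 4∣1+q → inj₂ (subst (4 ∣_) (+-comm t (q * t)) (∣m⇒∣m*n t 4∣1+q) , u , refl))
  -- For t = 2u + 1, s t = 2(su + q) + 1, and the cancellation leaves u(u + 1) · 2sq + q(q + 1) =
  -- 4w.
  ]′ (4∣n*[1+n]⇒4∣n⊎4∣1+n q (∣m+n∣m⇒∣n (divides w (+-cancelʳ-≡ (u * suc u * s) _ _ (begin
      u * suc u * (s * q * 2) + q * suc q + u * suc u * s  ≡⟨ pronic q u ⟩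
      (s * u + q) * suc (s * u + q)                        ≡⟨ totalNorm-odd (s * u + q) ⟨
      totalNorm (suc ((s * u + q) * 2))                    ≡⟨ cong totalNorm (product q u) ⟩
      totalNorm (s * t)                                    ≡⟨ eq ⟩
      w * 4 + totalNorm t * s                              ≡⟨ cong (λ g → w * 4 + g * s) (totalNorm-odd u) ⟩
      w * 4 + u * suc u * s                                ∎)))
      -- Two even factors make the first term a multiple of 4, leaving 4 ∣ q(q + 1).
      (*-pres-∣ (2∣n*[1+n] u) (n∣m*n (s * q)))))
  where
  open ≡-Reasoning
  s = suc (q * 2)
  pronic : ∀ q u → u * suc u * (suc (q * 2) * q * 2) + q * suc q + u * suc u * suc (q * 2)
    ≡ (suc (q * 2) * u + q) * suc (suc (q * 2) * u + q)
  pronic = solve-∀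
  product : ∀ q u → suc ((suc (q * 2) * u + q) * 2) ≡ suc (q * 2) * suc (u * 2)
  product = solve-∀

-- With s = 2r and t = 2u, the total for s t = 4ru is (2ru)², a multiple of 4. Hence 4 divides 2ru²,
-- so 2 divides ru² and therefore ru, and 8 divides 4ru.
even-index : ∀ r u w → totalNorm (r * 2 * (u * 2)) ≡ w * 4 + totalNorm (u * 2) * (r * 2) → 8 ∣ r * 2 * (u * 2)
even-index r u w eq = subst (8 ∣_) (sym (product r u)) (*-monoˡ-∣ 4 2∣ru)
  where
  open ≡-Reasoning
  product : ∀ r u → r * 2 * (u * 2) ≡ r * u * 4
  product = solve-∀
  product′ : ∀ r u → r * u * 2 * 2 ≡ r * 2 * (u * 2)
  product′ = solve-∀
  square : ∀ r u → r * u * 2 * (r * u * 2) ≡ r * u * (r * u) * 4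
  square = solve-∀
  4∣u*u*2r : 4 ∣ u * u * (r * 2)
  4∣u*u*2r = ∣m+n∣m⇒∣n (divides (r * u * (r * u)) (begin
    w * 4 + u * u * (r * 2)                ≡⟨ cong (λ g → w * 4 + g * (r * 2)) (totalNorm-even u) ⟨
    w * 4 + totalNorm (u * 2) * (r * 2)    ≡⟨ eq ⟨
    totalNorm (r * 2 * (u * 2))            ≡⟨ cong totalNorm (product′ r u) ⟨
    totalNorm (r * u * 2 * 2)              ≡⟨ totalNorm-even (r * u * 2) ⟩
    r * u * 2 * (r * u * 2)                ≡⟨ square r u ⟩
    r * u * (r * u) * 4                    ∎)) (n∣m*n w)
  2∣ru : 2 ∣ r * u
  2∣ru = [ ∣n⇒∣m*n r ∘ 2∣n*n⇒2∣n u , ∣m⇒∣m*n u ]′ (euclidsLemma (u * u) r prime[2]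
    (*-cancelʳ-∣ 2 (subst (4 ∣_) (sym (*-assoc (u * u) r 2)) 4∣u*u*2r)))

-- Integer congruences and the three cases.

∣⇒≡0 : ∀ {d m} → d ∣ m → (+ m) ≡ (+ 0) [mod d ]
∣⇒≡0 {d} {m} (divides q eq) = ℤ.divides (+ q) (trans (ℤ.+-identityʳ (+ m)) (trans (cong +_ eq) (ℤ.pos-* q d)))

∣+⇒≡- : ∀ {d} m n → d ∣ m + n → (+ m) ≡ (- (+ n)) [mod d ]
∣+⇒≡- {d} m n (divides q eq) =
  ℤ.divides (+ q) (trans (cong (ℤ._+_ (+ m)) (ℤ.neg-involutive (+ n))) (trans (cong +_ eq) (ℤ.pos-* q d)))

odd⇒-≡±1 : ∀ u → ((- (+ suc (u * 2))) ≡ 1ℤ [mod 4 ]) ⊎ ((- (+ suc (u * 2))) ≡ (- 1ℤ) [mod 4 ])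
odd⇒-≡±1 u with even⊎odd u
... | inj₁ (a , refl) = inj₂ (ℤ.divides (- (+ a))
  (trans (cong (λ m → - (1ℤ ℤ.+ m) ℤ.- - 1ℤ) (trans (ℤ.pos-* (a * 2) 2) (cong (ℤ._* + 2) (ℤ.pos-* a 2)))) (regroup (+ a))))
  where
  regroup : ∀ a → - (1ℤ ℤ.+ a ℤ.* + 2 ℤ.* + 2) ℤ.- - 1ℤ ≡ - a ℤ.* + 4
  regroup = ℤ-Solver.solve-∀
-- The number is now 3 + 4a, and -(3 + 4a) - 1 = -4(a + 1).
... | inj₂ (a , refl) = inj₁ (ℤ.divides (- (+ suc a))
  (trans (cong (λ m → - (+ 3 ℤ.+ m) ℤ.- 1ℤ) (trans (ℤ.pos-* (a * 2) 2) (cong (ℤ._* + 2) (ℤ.pos-* a 2)))) (regroup (+ a))))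
  where
  regroup : ∀ a → - (+ 3 ℤ.+ a ℤ.* + 2 ℤ.* + 2) ℤ.- 1ℤ ≡ - (1ℤ ℤ.+ a) ℤ.* + 4
  regroup = ℤ-Solver.solve-∀

proposition3p1 : (n k t : ℕ) .{{_ : NonZero n}} .{{_ : NonZero k}} .{{_ : NonZero t}} →
    t ∣ 2 * n * k →
    (J : Subset (modulus n k t)) → IsSubgroup {{modulus-nonZero n k t}} J → ∣ J ∣ ≡ t →
    (∃ λ A → IsIntegerHeffterArray n k t J A) →
    (t ∣ n * k →
    (+ (n * k)) ≡ (+ 0) [mod 4 ] ⊎
    ((+ (n * k)) ≡ (- (+ t)) [mod 4 ] ×
    ((- (+ t)) ≡ 1ℤ [mod 4 ] ⊎ (- (+ t)) ≡ (- 1ℤ) [mod 4 ])))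
    × (t ≡ 2 * n * k → 2 ∣ k)
    × (t ≢ 2 * n * k → ¬ (t ∣ n * k) → (+ (t + 2 * n * k)) ≡ (+ 0) [mod 8 ])
proposition3p1 n@(suc _) k t (divides c 2nk≡ct) J isSubgroup ∣J∣≡t (A , integerHeffter) = part₁ , part₂ , part₃
  where
  open ≡-Reasoning
  -- The index v / t is c + 1 with c = 2nk / t. It is passed as `s` with an equation so that each
  -- case can present it in its own shape.
  v≡ : ∀ {s} → s ≡ suc c → modulus n k t ≡ s * t
  v≡ {s} s≡ = begin
    2 * n * k + t  ≡⟨ cong (_+ t) 2nk≡ct ⟩
    c * t + t      ≡⟨ +-comm (c * t) t ⟩
    suc c * t      ≡⟨ cong (_* t) s≡ ⟨
    s * t          ∎

  totalNorm≡ : ∀ {s} → s ≡ suc c → ∃ λ w → totalNorm (s * t) ≡ w * 4 + totalNorm t * s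
  totalNorm≡ s≡ with w , eq ← totalNorm-heffter isSubgroup ∣J∣≡t integerHeffter (v≡ s≡) =
    w , trans (cong totalNorm (sym (v≡ s≡))) eq

  part₁ : t ∣ n * k → _
  -- From nk = q t follows c = 2q, so the index is odd.
  part₁ (divides q nk≡qt) with uncurry (odd-index q t) (totalNorm≡ (cong suc 2q≡c))
    where
    2q≡c : q * 2 ≡ c
    2q≡c = *-cancelʳ-≡ (q * 2) c t (begin
      q * 2 * t    ≡⟨ cong (_* t) (*-comm q 2) ⟩
      2 * q * t    ≡⟨ *-assoc 2 q t ⟩
      2 * (q * t)  ≡⟨ cong (2 *_) nk≡qt ⟨
      2 * (n * k)  ≡⟨ *-assoc 2 n k ⟨
      2 * n * k    ≡⟨ 2nk≡ct ⟩
      c * t        ∎)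
  ... | inj₁ 4∣qt = inj₁ (∣⇒≡0 (subst (4 ∣_) (sym nk≡qt) 4∣qt))
  ... | inj₂ (4∣qt+t , u , refl) =
    inj₂ (∣+⇒≡- (n * k) t (subst (λ m → 4 ∣ m + t) (sym nk≡qt) 4∣qt+t) , odd⇒-≡±1 u)

  part₂ : t ≡ 2 * n * k → 2 ∣ k
  -- Here c = 1, so the index is 2; row `zero` exists since `n` is a successor.
  part₂ t≡2nk = index-2⇒2∣k isSubgroup ∣J∣≡t integerHeffter (v≡ (cong suc 1≡c)) zero
    where
    1≡c : 1 ≡ c
    1≡c = *-cancelʳ-≡ 1 c t (trans (*-identityˡ t) (trans t≡2nk 2nk≡ct))

  part₃ : t ≢ 2 * n * k → ¬ (t ∣ n * k) → (+ (t + 2 * n * k)) ≡ (+ 0) [mod 8 ]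
  part₃ _ t∤nk with even⊎odd c
  -- An even c would make t divide nk.
  ... | inj₁ (q , refl) = contradiction (divides q (*-cancelˡ-≡ (n * k) (q * t) 2 (begin
      2 * (n * k)  ≡⟨ *-assoc 2 n k ⟨
      2 * n * k    ≡⟨ 2nk≡ct ⟩
      q * 2 * t    ≡⟨ cong (_* t) (*-comm q 2) ⟩
      2 * q * t    ≡⟨ *-assoc 2 q t ⟩
      2 * (q * t)  ∎))) t∤nk
  ... | inj₂ (q , refl)
    -- The odd multiple c t equals the even number 2nk, so t is even. The index c + 1 computes to
    -- `suc q * 2`.
    with divides u refl ← 2∣odd*n⇒2∣n q t
      (divides (n * k) (trans (sym 2nk≡ct) (trans (*-assoc 2 n k) (*-comm 2 (n * k))))) =
    ∣⇒≡0 (subst (8 ∣_) (trans (sym (v≡ refl)) (+-comm (2 * n * k) t)) (uncurry (even-index (suc q) u) (totalNorm≡ refl)))
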